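{- Let $n\ge1$, $\mathcal I=\{1,\dots,n\}$, and let $\mathcal X$ and $\mathcal Y_i$ ($i\in\mathcal I$) be finite nonempty sets. Let $(\mathcal X,\mathcal Y_i,C_i)$, $i\in\mathcal I$, be channels and $\pi$ a prior on $\mathcal X$. Let $\mathcal X'$ be a nonempty proper subset of $\mathcal X$ with $\max_{x'\in\mathcal X'}\pi[x']\le\min_{x\in\mathcal X\setminus\mathcal X'}\pi[x]$, let $\epsilon=\sum_{x'\in\mathcal X'}\pi[x']$, and let $\pi'=\pi|_{\mathcal X\setminus\mathcal X'}$. Assume $\epsilon<\max_{j\in\mathcal I}V(\pi,C_j)$. Then $$I_\infty\bigl(\pi,\ \parallel_{i\in\mathcal I}C_i\bigr)\ \le\ \sum_{i\in\mathcal I}I_\infty(\pi,C_i)+(\#\mathcal I-1)\cdot\bigl(H^{\min}(\pi')-H_\infty(\pi')\bigr)+\log\frac{\max_{j\in\mathcal I}V(\pi,C_j)}{\max_{j\in\mathcal I}V(\pi,C_j)-\epsilon}.$$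
   Context: A (discrete) channel $(\mathcal X,\mathcal Y,C)$ consists of finite sets $\mathcal X,\mathcal Y$ and a matrix $C$ with entries $C[x,y]\ge 0$ and $\sum_{y}C[x,y]=1$ for each $x$. A prior on $\mathcal X$ is a probability distribution on $\mathcal X$. The $n$-ary parallel composition with shared input $\parallel_{i\in\mathcal I}C_i$ is the channel from $\mathcal X$ to $\mathcal Y_1\times\cdots\times\mathcal Y_n$ whose entry at $(x,(y_1,\dots,y_n))$ is $\prod_i C_i[x,y_i]$. The sub-probability distribution $\pi|_{\mathcal X\setminus\mathcal X'}$ on $\mathcal X$ equals $0$ at $x\in\mathcal X'$ and $\pi[x]$ at $x\notin\mathcal X'$. For a (sub-)probability distribution $\pi$ on $\mathcal X$: $V(\pi)=\max_{x}\pi[x]$, $V(\pi,C)=\sum_y\max_x\pi[x]C[x,y]$, $H_\infty(\pi)=-\log V(\pi)$, $H_\infty(\pi,C)=-\log V(\pi,C)$, $I_\infty(\pi,C)=H_\infty(\pi)-H_\infty(\pi,C)$ (min-entropy leakage), and $H^{\min}(\pi)=-\log\min\{\pi[x]: x\in\mathcal X,\ \pi[x]\ne0\}$. Logarithms are to base 2. -}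

module Defs where

open import Level using (Level; _⊔_; suc)
open import Data.Nat.Base as ℕ using (ℕ)
open import Data.Bool.Base using (if_then_else_)
open import Data.Fin.Base as Fin using (Fin)
open import Data.Fin.Subset using (Subset; Nonempty; _∈_)
open import Data.Fin.Subset.Properties using (_∈?_)
open import Data.List.Base as List using (List)
open import Data.Product.Base using (∃; _×_; proj₁)
open import Data.Vec.Functional using (Vector; foldr; head; tail; toList)
open import Relation.Nullary using (¬_; ¬?; does)
open import Relation.Unary using (Pred)
open import Relation.Binary.Core using (Rel)
open import Relation.Binary.Bundles using (DecTotalOrder)
open import Relation.Binary.Structures using (IsDecTotalOrder)
open import Algebra.Bundles using (CommutativeRing)
import Algebra.Definitions.RawMonoid as RawMonoid
import Data.List.Extrema as Extrema
import Relation.Binary.Construct.NonStrictToStrict as NonStrictToStrict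

-- The (classical) real numbers, axiomatised as a Dedekind-complete ordered
-- field; up to isomorphism there is only one.  As in the usual total
-- conventions, nothing is said about 0# ⁻¹.
record Reals (c ℓ₁ ℓ₂ : Level) : Set (suc (c ⊔ ℓ₁ ⊔ ℓ₂)) where
  field
    commutativeRing : CommutativeRing c ℓ₁

  open CommutativeRing commutativeRing public

  infix  4 _≤_
  infix  8 _⁻¹

  field
    _≤_             : Rel Carrier ℓ₂
    isDecTotalOrder : IsDecTotalOrder _≈_ _≤_
    _⁻¹             : Carrier → Carrier
    1≉0             : ¬ (1# ≈ 0#)
    ⁻¹-inverseʳ     : ∀ x → ¬ (x ≈ 0#) → x * x ⁻¹ ≈ 1#
    +-monoʳ-≤       : ∀ x {y z} → y ≤ z → x + y ≤ x + z
    *-nonneg        : ∀ {x y} → 0# ≤ x → 0# ≤ y → 0# ≤ x * y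

  UpperBound : ∀ {p} → Pred Carrier p → Pred Carrier (c ⊔ ℓ₂ ⊔ p)
  UpperBound P b = ∀ x → P x → x ≤ b

  field
    supremum : (P : Pred Carrier (c ⊔ ℓ₁ ⊔ ℓ₂)) → ∃ P → ∃ (UpperBound P) →
               ∃ λ s → UpperBound P s × (∀ b → UpperBound P b → s ≤ b)

  decTotalOrder : DecTotalOrder c ℓ₁ ℓ₂
  decTotalOrder = record { isDecTotalOrder = isDecTotalOrder }

  open DecTotalOrder decTotalOrder public
    using (totalOrder; _≟_; _≤?_)

  open NonStrictToStrict _≈_ _≤_ public using (_<_)

  infixl 7 _/_
  _/_ : Carrier → Carrier → Carrier
  x / y = x * y ⁻¹

-- The base-2 logarithm, characterised as the only monotone homomorphism from
-- the positive reals under multiplication to the reals under addition that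
-- sends 2 to 1.  Values of log outside the positive reals are unconstrained.
record BinaryLogarithm {c ℓ₁ ℓ₂} (ℝ : Reals c ℓ₁ ℓ₂) : Set (c ⊔ ℓ₁ ⊔ ℓ₂) where
  open Reals ℝ

  field
    log      : Carrier → Carrier
    log-mono : ∀ {x y} → 0# < x → x ≤ y → log x ≤ log y
    log-*    : ∀ {x y} → 0# < x → 0# < y → log (x * y) ≈ log x + log y
    log-2    : log (1# + 1#) ≈ 1#

-- Cardinality of the product of finite sets with the given cardinalities.
#∏ : ∀ {n} → (Fin n → ℕ) → ℕ
#∏ = foldr ℕ._*_ 1

-- The bijection Fin (#∏ k) ≅ Fin (k 0) × ⋯ × Fin (k (n - 1)), given by its
-- coordinate projections.
proj : ∀ {n} (k : Fin n → ℕ) → Fin (#∏ k) → (i : Fin n) → Fin (k i)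
proj k y Fin.zero    = Fin.quotient (#∏ (tail k)) y
proj k y (Fin.suc i) = proj (tail k) (Fin.remainder {head k} (#∏ (tail k)) y) i

elements : ∀ {m} → Subset m → List (Fin m)
elements S = List.filter (_∈? S) (List.allFin _)

-- Finite sets are represented by Fin m, and nonempty ones by Fin (suc m).
module Leakage {c ℓ₁ ℓ₂} (ℝ : Reals c ℓ₁ ℓ₂) (log₂ : BinaryLogarithm ℝ) where
  open Reals ℝ
  open BinaryLogarithm log₂ public using (log)
  open Extrema totalOrder using (max; min)
  open RawMonoid +-rawMonoid public using (sum) renaming (_×_ to _·_)
  open RawMonoid *-rawMonoid public using () renaming (sum to product)

  private variable
    m n : ℕ

  maximum : Vector Carrier (ℕ.suc m) → Carrier
  maximum f = max (head f) (toList (tail f))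

  -- Extrema over a nonempty subset; the witness of nonemptiness only serves as
  -- the initial value of the fold.
  maxOver minOver : Vector Carrier m → (S : Subset m) → Nonempty S → Carrier
  maxOver f S ne = max (f (proj₁ ne)) (List.map f (elements S))
  minOver f S ne = min (f (proj₁ ne)) (List.map f (elements S))

  restrict : Vector Carrier m → Subset m → Vector Carrier m
  restrict f S x = if does (x ∈? S) then f x else 0#

  sumOver : Vector Carrier m → Subset m → Carrier
  sumOver f S = sum (restrict f S)

  record IsPrior (π : Vector Carrier m) : Set (ℓ₁ ⊔ ℓ₂) where
    field
      nonneg : ∀ x → 0# ≤ π x
      total  : sum π ≈ 1#

  Matrix : ℕ → ℕ → Set c
  Matrix m k = Fin m → Fin k → Carrier

  record IsChannel {m k} (C : Matrix m k) : Set (ℓ₁ ⊔ ℓ₂) where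
    field
      nonneg : ∀ x y → 0# ≤ C x y
      total  : ∀ x → sum (C x) ≈ 1#

  ∥ : {k : Fin n → ℕ} → (∀ i → Matrix m (k i)) → Matrix m (#∏ k)
  ∥ {k = k} C x y = product (λ i → C i x (proj k y i))

  V : Vector Carrier (ℕ.suc m) → Carrier
  V π = maximum π

  V[_,_] : ∀ {k} → Vector Carrier (ℕ.suc m) → Matrix (ℕ.suc m) k → Carrier
  V[ π , C ] = sum (λ y → maximum (λ x → π x * C x y))

  H∞ : Vector Carrier (ℕ.suc m) → Carrier
  H∞ π = - log (V π)

  H∞[_,_] : ∀ {k} → Vector Carrier (ℕ.suc m) → Matrix (ℕ.suc m) k → Carrier
  H∞[ π , C ] = - log V[ π , C ]

  I∞[_,_] : ∀ {k} → Vector Carrier (ℕ.suc m) → Matrix (ℕ.suc m) k → Carrier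
  I∞[ π , C ] = H∞ π - H∞[ π , C ]

  -- The minimum of the nonzero entries.  The initial value 1# has no effect for
  -- a nonzero sub-probability distribution, whose entries are all at most 1.
  minNonzero : Vector Carrier m → Carrier
  minNonzero π = min 1# (List.filter (λ p → ¬? (p ≟ 0#)) (toList π))

  Hmin : Vector Carrier m → Carrier
  Hmin π = - log (minNonzero π)

{-# OPTIONS --safe #-}
-- Write W = V(π, ∥ C), W′ = V(π′, ∥ C), V = maxⱼ V(π, Cⱼ), and let μ be the
-- least nonzero value of π′.  Removing the atoms of X′ costs at most their mass,
-- so W ≤ W′ + ε; forgetting all outputs but one cannot help the adversary, so
-- V ≤ W.  Together these give W (V - ε) ≤ V W′.  On the support of π′,
-- π′(x) ∏ᵢ Cᵢ[x,yᵢ] μⁿ⁻¹ ≤ ∏ᵢ π(x) Cᵢ[x,yᵢ], hence W′ μⁿ⁻¹ ≤ ∏ᵢ V(π, Cᵢ).  The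
-- claim is the logarithm of these inequalities, because V(π) ≤ V(π′): the atoms
-- outside X′ dominate those in X′.
module Submission where

open import Defs
open import Data.Bool.Base using (true; false)
open import Data.Empty using (⊥-elim)
open import Data.Nat.Base as ℕ using (ℕ; suc; zero; _∸_)
open import Data.Fin.Base using (Fin; zero; suc; combine; quotient; remainder; _↑ˡ_; _↑ʳ_)
open import Data.Fin.Properties using (remQuot-combine)
open import Data.Fin.Subset using (Subset; Nonempty; ∁; _∈_; _∉_)
open import Data.Fin.Subset.Properties using (_∈?_; x∈∁p⇒x∉p; x∉p⇒x∈∁p)
import Data.List.Base as List
open import Data.List.Membership.Propositional.Properties
  using (∈-filter⁺; ∈-tabulate⁺; ∈-allFin; ∈-map⁺)
import Data.List.Relation.Unary.All as All
import Data.List.Relation.Unary.All.Properties as All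
open import Data.Product.Base using (_,_; proj₁; proj₂)
open import Data.Sum.Base using (inj₁; inj₂)
open import Data.Vec.Functional using (Vector; tail; toList; replicate)
open import Function.Base using (_∘_)
open import Level using (Level)
open import Relation.Binary.Bundles using (TotalOrder)
import Relation.Binary.PropositionalEquality.Core as ≡
open import Relation.Nullary using (¬_; ¬?; yes; no; does)

import Algebra.Properties.Ring as RingProperties
import Algebra.Properties.CommutativeMonoid.Sum as MonoidSum
import Algebra.Properties.CommutativeMonoid.Mult as MonoidMult
import Algebra.Properties.Semiring.Sum as SemiringSum
import Algebra.Solver.Ring.NaturalCoefficients.Default as SemiringSolver
import Data.List.Extrema as Extrema
import Relation.Binary.Reasoning.PartialOrder as PartialOrderReasoning

-- Arithmetic of ordered fields.

module OrderedField {c ℓ₁ ℓ₂ : Level} (ℝ : Reals c ℓ₁ ℓ₂) where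
  open Reals ℝ
  open RingProperties ring using (-‿involutive; -1*x≈-x; \\-leftDividesʳ; //-rightDividesˡ)
  open SemiringSolver commutativeSemiring using (solve; _:+_; _:*_; _:=_)
  open TotalOrder totalOrder public using (poset; total; antisym)
    renaming (refl to ≤-refl; reflexive to ≤-reflexive; trans to ≤-trans)
  open PartialOrderReasoning poset using (begin_; begin-equality_; step-≤; step-≈-⟩; step-≈-⟨; _∎)

  ≰⇒> : ∀ {x y} → ¬ (x ≤ y) → y < x
  ≰⇒> {x} {y} x≰y with total x y
  ... | inj₁ x≤y = ⊥-elim (x≰y x≤y)
  ... | inj₂ y≤x = y≤x , λ y≈x → x≰y (≤-reflexive (sym y≈x))

  <⇒≱ : ∀ {x y} → x < y → ¬ (y ≤ x)
  <⇒≱ (x≤y , x≉y) y≤x = x≉y (antisym x≤y y≤x)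

  <-≤-trans : ∀ {x y z} → x < y → y ≤ z → x < z
  <-≤-trans x<y@(x≤y , _) y≤z =
    ≤-trans x≤y y≤z , λ x≈z → <⇒≱ x<y (≤-trans y≤z (≤-reflexive (sym x≈z)))

  ≤-<-trans : ∀ {x y z} → x ≤ y → y < z → x < z
  ≤-<-trans x≤y y<z@(y≤z , _) =
    ≤-trans x≤y y≤z , λ x≈z → <⇒≱ y<z (≤-trans (≤-reflexive (sym x≈z)) x≤y)

  +-mono-≤ : ∀ {x y u v} → x ≤ y → u ≤ v → x + u ≤ y + v
  +-mono-≤ {x} {y} {u} {v} x≤y u≤v = begin
    x + u ≤⟨ +-monoʳ-≤ x u≤v ⟩
    x + v ≈⟨ +-comm x v ⟩
    v + x ≤⟨ +-monoʳ-≤ v x≤y ⟩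
    v + y ≈⟨ +-comm v y ⟩
    y + v ∎

  +-cancelˡ-≤ : ∀ x {y z} → x + y ≤ x + z → y ≤ z
  +-cancelˡ-≤ x {y} {z} x+y≤x+z = begin
    y               ≈⟨ \\-leftDividesʳ x y ⟨
    - x + (x + y)   ≤⟨ +-monoʳ-≤ (- x) x+y≤x+z ⟩
    - x + (x + z)   ≈⟨ \\-leftDividesʳ x z ⟩
    z               ∎

  x-y+y≈x : ∀ x y → x - y + y ≈ x
  x-y+y≈x x y = //-rightDividesˡ y x

  x≤y⇒0≤y-x : ∀ {x y} → x ≤ y → 0# ≤ y - x
  x≤y⇒0≤y-x {x} {y} x≤y = +-cancelˡ-≤ x (begin
    x + 0#      ≈⟨ +-identityʳ x ⟩
    x           ≤⟨ x≤y ⟩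
    y           ≈⟨ x-y+y≈x y x ⟨
    y - x + x   ≈⟨ +-comm _ _ ⟩
    x + (y - x) ∎)

  x<y⇒0<y-x : ∀ {x y} → x < y → 0# < y - x
  x<y⇒0<y-x {x} {y} (x≤y , x≉y) = x≤y⇒0≤y-x x≤y , λ 0≈y-x → x≉y
    (trans (sym (+-identityˡ x)) (trans (+-congʳ 0≈y-x) (x-y+y≈x y x)))

  *-monoˡ-≤ : ∀ {x y z} → 0# ≤ z → x ≤ y → z * x ≤ z * y
  *-monoˡ-≤ {x} {y} {z} 0≤z x≤y = begin
    z * x               ≈⟨ +-identityˡ _ ⟨
    0# + z * x          ≤⟨ +-mono-≤ (*-nonneg 0≤z (x≤y⇒0≤y-x x≤y)) ≤-refl ⟩
    z * (y - x) + z * x ≈⟨ distribˡ z (y - x) x ⟨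
    z * (y - x + x)     ≈⟨ *-congˡ (x-y+y≈x y x) ⟩
    z * y               ∎

  *-monoʳ-≤ : ∀ {x y z} → 0# ≤ z → x ≤ y → x * z ≤ y * z
  *-monoʳ-≤ {x} {y} {z} 0≤z x≤y = begin
    x * z ≈⟨ *-comm x z ⟩
    z * x ≤⟨ *-monoˡ-≤ 0≤z x≤y ⟩
    z * y ≈⟨ *-comm z y ⟩
    y * z ∎

  *-mono-≤ : ∀ {x y u v} → 0# ≤ x → 0# ≤ u → x ≤ y → u ≤ v → x * u ≤ y * v
  *-mono-≤ 0≤x 0≤u x≤y u≤v = ≤-trans (*-monoʳ-≤ 0≤u x≤y) (*-monoˡ-≤ (≤-trans 0≤x x≤y) u≤v)

  -- If `1# ≤ 0#`, then `- 1#` is nonnegative, and hence so is its square, which is `1#`.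
  0≤1 : 0# ≤ 1#
  0≤1 with total 0# 1#
  ... | inj₁ 0≤1 = 0≤1
  ... | inj₂ 1≤0 = begin
    0#          ≤⟨ *-nonneg 0≤-1 0≤-1 ⟩
    - 1# * - 1# ≈⟨ -1*x≈-x (- 1#) ⟩
    - - 1#      ≈⟨ -‿involutive 1# ⟩
    1#          ∎
    where
    0≤-1 : 0# ≤ - 1#
    0≤-1 = ≤-trans (x≤y⇒0≤y-x 1≤0) (≤-reflexive (+-identityˡ _))

  0<1 : 0# < 1#
  0<1 = 0≤1 , λ 0≈1 → 1≉0 (sym 0≈1)

  *-pos : ∀ {x y} → 0# < x → 0# < y → 0# < x * y
  *-pos {x} {y} (0≤x , 0≉x) (0≤y , 0≉y) = *-nonneg 0≤x 0≤y , λ 0≈xy → 0≉y (begin-equality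
    0#                ≈⟨ zeroˡ _ ⟨
    0# * x ⁻¹         ≈⟨ *-congʳ 0≈xy ⟩
    x * y * x ⁻¹      ≈⟨ solve 3 (λ a b d → a :* b :* d := a :* d :* b) refl x y (x ⁻¹) ⟩
    x * x ⁻¹ * y      ≈⟨ *-congʳ (⁻¹-inverseʳ x (0≉x ∘ sym)) ⟩
    1# * y            ≈⟨ *-identityˡ y ⟩
    y                 ∎)

  ⁻¹-pos : ∀ {x} → 0# < x → 0# < x ⁻¹
  ⁻¹-pos {x} (0≤x , 0≉x) = ≰⇒> λ x⁻¹≤0 → <⇒≱ 0<1 (begin
    1#         ≈⟨ ⁻¹-inverseʳ x (0≉x ∘ sym) ⟨
    x * x ⁻¹   ≤⟨ *-monoˡ-≤ 0≤x x⁻¹≤0 ⟩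
    x * 0#     ≈⟨ zeroʳ x ⟩
    0#         ∎)

  *≤⇒≤/ : ∀ {x y z} → 0# < y → x * y ≤ z → x ≤ z / y
  *≤⇒≤/ {x} {y} {z} 0<y@(_ , 0≉y) xy≤z = begin
    x              ≈⟨ *-identityʳ x ⟨
    x * 1#         ≈⟨ *-congˡ (⁻¹-inverseʳ y (0≉y ∘ sym)) ⟨
    x * (y * y ⁻¹) ≈⟨ *-assoc _ _ _ ⟨
    x * y * y ⁻¹   ≤⟨ *-monoʳ-≤ (proj₁ (⁻¹-pos 0<y)) xy≤z ⟩
    z / y          ∎

  /-pos : ∀ {x y} → 0# < x → 0# < y → 0# < x / y
  /-pos 0<x 0<y = *-pos 0<x (⁻¹-pos 0<y)

  -- For `e < w`, the bound `w ≤ w′ + e` gives `w ≤ w′ * (w / (w - e))`. This factor does not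
  -- increase with `w`, so the smaller `v` may take the place of `w` in it. In cleared form, adding
  -- `w * e` turns the left side into `w * v`, and then `w * v ≤ w′ * v + e * v ≤ w′ * v + e * w`.
  w*[v-e]≤v*w′ : ∀ {w w′ v e} → 0# ≤ e → 0# ≤ v → v ≤ w → w ≤ w′ + e → w * (v - e) ≤ v * w′
  w*[v-e]≤v*w′ {w} {w′} {v} {e} 0≤e 0≤v v≤w w≤w′+e = +-cancelˡ-≤ (w * e) (begin
    w * e + w * (v - e)   ≈⟨ solve 3 (λ a b d → a :* b :+ a :* d := a :* (d :+ b)) refl w e (v - e) ⟩
    w * (v - e + e)       ≈⟨ *-congˡ (x-y+y≈x v e) ⟩
    w * v                 ≤⟨ *-monoʳ-≤ 0≤v w≤w′+e ⟩
    (w′ + e) * v          ≈⟨ solve 3 (λ a b d → (a :+ b) :* d := d :* b :+ d :* a) refl w′ e v ⟩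
    v * e + v * w′        ≤⟨ +-mono-≤ (*-monoʳ-≤ 0≤e v≤w) ≤-refl ⟩
    w * e + v * w′        ∎)

module MinEntropy {c ℓ₁ ℓ₂ : Level} (ℝ : Reals c ℓ₁ ℓ₂) (log₂ : BinaryLogarithm ℝ) where
  open Reals ℝ hiding (zero)
  open OrderedField ℝ
  open Leakage ℝ log₂
  open BinaryLogarithm log₂ using (log-mono; log-*)
  open RingProperties ring using (-‿involutive; +-identityˡ-unique)
  open Extrema totalOrder using (⊥≤max; xs≤max; max≤v⁺; min≤xs; v<min⁺)
  open PartialOrderReasoning poset using (begin_; begin-equality_; step-≤; step-≈-⟩; step-≈-⟨; _∎)
  module ∑ = SemiringSum semiring
  module ∏ = MonoidSum *-commutativeMonoid
  open MonoidMult +-commutativeMonoid using (×-distrib-+)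
  open SemiringSolver commutativeSemiring using (solve; _:+_; _:*_; _:=_)

  private variable
    m n : ℕ

  -- Finite sums and products.

  sum-mono-≤ : {f g : Vector Carrier n} → (∀ i → f i ≤ g i) → sum f ≤ sum g
  sum-mono-≤ {zero}  f≤g = ≤-refl
  sum-mono-≤ {suc n} f≤g = +-mono-≤ (f≤g zero) (sum-mono-≤ (f≤g ∘ suc))

  sum-nonneg : {f : Vector Carrier n} → (∀ i → 0# ≤ f i) → 0# ≤ sum f
  sum-nonneg {n} 0≤f = ≤-trans (≤-reflexive (sym (∑.sum-replicate-zero n))) (sum-mono-≤ 0≤f)

  term≤sum : {f : Vector Carrier n} → (∀ i → 0# ≤ f i) → ∀ i → f i ≤ sum f
  term≤sum 0≤f zero    = ≤-trans (≤-reflexive (sym (+-identityʳ _))) (+-monoʳ-≤ _ (sum-nonneg (0≤f ∘ suc)))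
  term≤sum 0≤f (suc i) = ≤-trans (term≤sum (0≤f ∘ suc) i)
    (≤-trans (≤-reflexive (sym (+-identityˡ _))) (+-mono-≤ (0≤f zero) ≤-refl))

  product-nonneg : {f : Vector Carrier n} → (∀ i → 0# ≤ f i) → 0# ≤ product f
  product-nonneg {zero}  0≤f = 0≤1
  product-nonneg {suc n} 0≤f = *-nonneg (0≤f zero) (product-nonneg (0≤f ∘ suc))

  product-pos : {f : Vector Carrier n} → (∀ i → 0# < f i) → 0# < product f
  product-pos {zero}  0<f = 0<1
  product-pos {suc n} 0<f = *-pos (0<f zero) (product-pos (0<f ∘ suc))

  product-mono-≤ : {f g : Vector Carrier n} → (∀ i → 0# ≤ f i) → (∀ i → f i ≤ g i) →
                   product f ≤ product g
  product-mono-≤ {zero}  0≤f f≤g = ≤-refl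
  product-mono-≤ {suc n} 0≤f f≤g =
    *-mono-≤ (0≤f zero) (product-nonneg (0≤f ∘ suc)) (f≤g zero) (product-mono-≤ (0≤f ∘ suc) (f≤g ∘ suc))

  -- Sums over a product of finite sets.

  sum-↑ : ∀ l (f : Fin (l ℕ.+ n) → Carrier) → sum f ≈ sum (λ i → f (i ↑ˡ n)) + sum (λ i → f (l ↑ʳ i))
  sum-↑ zero    f = sym (+-identityˡ _)
  sum-↑ (suc l) f = trans (+-congˡ (sum-↑ l (f ∘ suc))) (sym (+-assoc _ _ _))

  sum-combine : ∀ k l (f : Fin (k ℕ.* l) → Carrier) →
                sum f ≈ sum (λ (a : Fin k) → sum (λ (b : Fin l) → f (combine a b)))
  sum-combine zero    l f = refl
  sum-combine (suc k) l f = trans (sum-↑ l f) (+-congˡ (sum-combine k l (f ∘ (l ↑ʳ_))))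

  -- `proj` reads coordinates off by `quotient` and `remainder`, whereas `sum-combine` lists indices
  -- as `combine a b`; this lemma reconciles the two.
  sum-remQuot : ∀ k l (f : Fin k → Fin l → Carrier) →
                sum (λ y → f (quotient {k} l y) (remainder {k} l y)) ≈ sum (λ a → sum (f a))
  sum-remQuot k l f = trans (sum-combine k l _) (∑.sum-cong-≋ λ a → ∑.sum-cong-≋ λ b →
    reflexive (≡.cong (λ p → f (proj₁ p) (proj₂ p)) (remQuot-combine {k} {l} a b)))

  -- General distributivity: multiplying out a product of sums yields one term per tuple. The
  -- induction splits off the first coordinate and pulls the sum over the remaining ones out as a
  -- common factor.
  sum-product-proj : (k : Fin n → ℕ) (f : ∀ i → Fin (k i) → Carrier) →
                     sum (λ y → product (λ i → f i (proj k y i))) ≈ product (λ i → sum (f i))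
  -- The empty product of sets has one element, and its term is the empty product, so the sum
  -- unfolds to `1# + 0#`.
  sum-product-proj {zero}  k f = +-identityʳ 1#
  sum-product-proj {suc n} k f = begin-equality
    sum (λ y → product (λ i → f i (proj k y i)))      ≈⟨ sum-remQuot (k zero) (#∏ (tail k)) (λ a b → f zero a * g b) ⟩
    sum (λ a → sum (λ b → f zero a * g b))            ≈⟨ ∑.sum-cong-≋ (λ a → ∑.*-distribˡ-sum (f zero a) g) ⟨
    sum (λ a → f zero a * sum g)                      ≈⟨ ∑.*-distribʳ-sum (sum g) (f zero) ⟨
    sum (f zero) * sum g                              ≈⟨ *-congˡ (sum-product-proj (tail k) (λ i → f (suc i))) ⟩
    product (λ i → sum (f i))                         ∎
    where
    g : Fin (#∏ (tail k)) → Carrier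
    g b = product (λ i → f (suc i) (proj (tail k) b i))

  -- Maxima.

  ≤maximum : (f : Vector Carrier (suc m)) → ∀ x → f x ≤ maximum f
  ≤maximum f zero    = ⊥≤max _ (toList (tail f))
  ≤maximum f (suc x) = All.tabulate⁻ (xs≤max (f zero) (toList (tail f))) x

  maximum≤ : (f : Vector Carrier (suc m)) → ∀ {v} → (∀ x → f x ≤ v) → maximum f ≤ v
  maximum≤ f f≤v = max≤v⁺ (f≤v zero) (All.tabulate⁺ (f≤v ∘ suc))

  maximum-mono-≤ : {f g : Vector Carrier (suc m)} → (∀ x → f x ≤ g x) → maximum f ≤ maximum g
  maximum-mono-≤ {f = f} {g} f≤g = maximum≤ f λ x → ≤-trans (f≤g x) (≤maximum g x)

  maximum-nonneg : {f : Vector Carrier (suc m)} → (∀ x → 0# ≤ f x) → 0# ≤ maximum f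
  maximum-nonneg {f = f} 0≤f = ≤-trans (0≤f zero) (≤maximum f zero)

  -- A guess chosen separately for each `y` does at least as well as one guess fixed in advance.
  -- This is why an additional observation never hurts the adversary.
  maximum-sum≤sum-maximum : (f : Fin (suc m) → Fin n → Carrier) →
    maximum (λ x → sum (f x)) ≤ sum (λ y → maximum (λ x → f x y))
  maximum-sum≤sum-maximum f = maximum≤ _ λ x → sum-mono-≤ λ y → ≤maximum (λ z → f z y) x

  -- Restriction to a subset, and the least nonzero entry.

  module _ (f : Vector Carrier m) (S : Subset m) where

    restrict-∈ : ∀ {x} → x ∈ S → restrict f S x ≈ f x
    restrict-∈ {x} x∈S with x ∈? S
    ... | yes _   = refl
    ... | no  x∉S = ⊥-elim (x∉S x∈S)

    restrict-∉ : ∀ {x} → x ∉ S → restrict f S x ≈ 0#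
    restrict-∉ {x} x∉S with x ∈? S
    ... | yes x∈S = ⊥-elim (x∉S x∈S)
    ... | no  _   = refl

    restrict-nonneg : (∀ x → 0# ≤ f x) → ∀ x → 0# ≤ restrict f S x
    restrict-nonneg 0≤f x with does (x ∈? S)
    ... | true  = 0≤f x
    ... | false = ≤-refl

    restrict-≤ : (∀ x → 0# ≤ f x) → ∀ x → restrict f S x ≤ f x
    restrict-≤ 0≤f x with does (x ∈? S)
    ... | true  = ≤-refl
    ... | false = 0≤f x

    ≤maxOver : (ne : Nonempty S) → ∀ {x} → x ∈ S → f x ≤ maxOver f S ne
    ≤maxOver ne {x} x∈S = All.lookup (xs≤max _ (List.map f (elements S)))
      (∈-map⁺ f (∈-filter⁺ (_∈? S) (∈-allFin x) x∈S))

    minOver≤ : (ne : Nonempty S) → ∀ {x} → x ∈ S → minOver f S ne ≤ f x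
    minOver≤ ne {x} x∈S = All.lookup (min≤xs _ (List.map f (elements S)))
      (∈-map⁺ f (∈-filter⁺ (_∈? S) (∈-allFin x) x∈S))

  restrict-∁+restrict : (f : Vector Carrier m) (S : Subset m) →
                        ∀ x → f x ≈ restrict f (∁ S) x + restrict f S x
  restrict-∁+restrict f S x with x ∈? S
  -- The case split already evaluates `restrict f S x`; only the restriction to the complement
  -- remains to be rewritten.
  ... | yes x∈S = sym (trans (+-congʳ (restrict-∉ f (∁ S) λ x∈∁S → x∈∁p⇒x∉p x∈∁S x∈S)) (+-identityˡ _))
  ... | no  x∉S = sym (trans (+-congʳ (restrict-∈ f (∁ S) (x∉p⇒x∈∁p x∉S))) (+-identityʳ _))

  -- The initial value `1#` of the fold is itself positive, so the case of no surviving entries is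
  -- covered too. Positivity permits dividing by the minimum and taking its logarithm.
  minNonzero-pos : (f : Vector Carrier m) → (∀ x → 0# ≤ f x) → 0# < minNonzero f
  minNonzero-pos f 0≤f = v<min⁺ 0<1 (All.zipWith (λ (0≤v , v≉0) → 0≤v , v≉0 ∘ sym)
    ( All.filter⁺ (λ p → ¬? (p ≟ 0#)) (All.tabulate⁺ {f = f} 0≤f)
    , All.all-filter (λ p → ¬? (p ≟ 0#)) (toList f)))

  minNonzero≤ : (f : Vector Carrier m) → ∀ {x} → ¬ (f x ≈ 0#) → minNonzero f ≤ f x
  minNonzero≤ f {x} fx≉0 = All.lookup (min≤xs 1# _)
    (∈-filter⁺ (λ p → ¬? (p ≟ 0#)) (∈-tabulate⁺ {f = f} x) fx≉0)

  -- Logarithms.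

  log-cong : ∀ {x y} → 0# < x → x ≈ y → log x ≈ log y
  -- Congruence comes from monotonicity, applied in both directions.
  log-cong 0<x x≈y = antisym (log-mono 0<x (≤-reflexive x≈y))
    (log-mono (<-≤-trans 0<x (≤-reflexive x≈y)) (≤-reflexive (sym x≈y)))

  -- Since `1# * 1# ≈ 1#`, the value `log 1#` equals its own double.
  log-1 : log 1# ≈ 0#
  log-1 = +-identityˡ-unique (log 1#) (log 1#)
    (trans (sym (log-* 0<1 0<1)) (log-cong (*-pos 0<1 0<1) (*-identityˡ 1#)))

  log-product : {f : Vector Carrier n} → (∀ i → 0# < f i) → log (product f) ≈ sum (log ∘ f)
  log-product {zero}  0<f = log-1
  log-product {suc n} 0<f =
    trans (log-* (0<f zero) (product-pos (0<f ∘ suc))) (+-congˡ (log-product (0<f ∘ suc)))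

  -- Channels and posterior vulnerability.

  ∥-isChannel : {k : Fin n → ℕ} {C : ∀ i → Matrix m (k i)} → (∀ i → IsChannel (C i)) → IsChannel (∥ C)
  ∥-isChannel {n = n} {k = k} {C} isC = record
    { nonneg = λ x y → product-nonneg λ i → IsChannel.nonneg (isC i) x (proj k y i)
    -- The row sum factorises into the row sums of the components. In the multiplicative monoid,
    -- `sum-replicate-zero` says that a product of ones is one.
    ; total  = λ x → trans (sum-product-proj k (λ i → C i x))
        (trans (∏.sum-cong-≋ λ i → IsChannel.total (isC i) x) (∏.sum-replicate-zero n))
    }

  module _ (π : Vector Carrier (suc m)) where

    -- The adversary may ignore the output: `π x` is spread over the row `D x`, which sums to one,
    -- and then the maximum moves inside the sum.
    V≤V[] : ∀ {l} {D : Matrix (suc m) l} → IsChannel D → V π ≤ V[ π , D ]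
    V≤V[] {D = D} isD = begin
      V π                                ≤⟨ maximum-mono-≤ (λ x → ≤-reflexive (begin-equality
        π x                                ≈⟨ *-identityʳ (π x) ⟨
        π x * 1#                           ≈⟨ *-congˡ (IsChannel.total isD x) ⟨
        π x * sum (D x)                    ≈⟨ ∑.*-distribˡ-sum (π x) (D x) ⟩
        sum (λ y → π x * D x y)            ∎)) ⟩
      maximum (λ x → sum (λ y → π x * D x y)) ≤⟨ maximum-sum≤sum-maximum (λ x y → π x * D x y) ⟩
      V[ π , D ]                         ∎

    -- The effect of also observing the output of `E`. The right side is a double sum, so that it
    -- can be matched with `∥` whichever of the two channels comes first.
    V[]≤sum-maximum : ∀ {l r} (D : Matrix (suc m) l) {E : Matrix (suc m) r} → IsChannel E →
      V[ π , D ] ≤ sum (λ y → sum (λ z → maximum (λ x → π x * (D x y * E x z))))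
    V[]≤sum-maximum D {E} isE = sum-mono-≤ λ y → begin
      maximum (λ x → π x * D x y)                         ≤⟨ maximum-mono-≤ (λ x → ≤-reflexive (begin-equality
        π x * D x y                                         ≈⟨ *-identityʳ _ ⟨
        π x * D x y * 1#                                    ≈⟨ *-congˡ (IsChannel.total isE x) ⟨
        π x * D x y * sum (E x)                             ≈⟨ ∑.*-distribˡ-sum (π x * D x y) (E x) ⟩
        sum (λ z → π x * D x y * E x z)                     ≈⟨ ∑.sum-cong-≋ (λ z → *-assoc (π x) (D x y) (E x z)) ⟩
        sum (λ z → π x * (D x y * E x z))                   ∎)) ⟩
      maximum (λ x → sum (λ z → π x * (D x y * E x z)))   ≤⟨ maximum-sum≤sum-maximum (λ x z → π x * (D x y * E x z)) ⟩
      sum (λ z → maximum (λ x → π x * (D x y * E x z)))   ∎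

    -- Induction on `j`. For the first channel, all the others together act as one additional
    -- channel; for a later one, the first channel is the addition to the composition of the rest.
    V[]-component≤V[∥] : {k : Fin n → ℕ} {C : ∀ i → Matrix (suc m) (k i)} → (∀ i → IsChannel (C i)) →
      ∀ j → V[ π , C j ] ≤ V[ π , ∥ C ]
    V[]-component≤V[∥] {k = k} {C} isC zero = ≤-trans
      (V[]≤sum-maximum (C zero) (∥-isChannel (isC ∘ suc)))
      (≤-reflexive (sym (sum-remQuot (k zero) (#∏ (tail k))
        λ a b → maximum (λ x → π x * (C zero x a * ∥ (λ i → C (suc i)) x b)))))
    V[]-component≤V[∥] {k = k} {C} isC (suc j) = begin
      V[ π , C (suc j) ] ≤⟨ V[]-component≤V[∥] (isC ∘ suc) j ⟩
      V[ π , E ]         ≤⟨ V[]≤sum-maximum E (isC zero) ⟩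
      sum (λ b → sum (λ a → maximum (λ x → π x * (E x b * C zero x a))))
        -- Here the additional channel stands second, while `∥` lists it first: the factors are
        -- commuted and then the two sums exchanged.
        ≤⟨ sum-mono-≤ (λ b → sum-mono-≤ (λ a → maximum-mono-≤ λ x →
             ≤-reflexive (*-congˡ {π x} (*-comm (E x b) (C zero x a))))) ⟩
      sum (λ b → sum (λ a → maximum (λ x → π x * (C zero x a * E x b))))
        ≈⟨ ∑.∑-comm (λ b a → maximum (λ x → π x * (C zero x a * E x b))) ⟩
      sum (λ a → sum (λ b → maximum (λ x → π x * (C zero x a * E x b))))
        ≈⟨ sum-remQuot (k zero) (#∏ (tail k)) (λ a b → maximum (λ x → π x * (C zero x a * E x b))) ⟨
      V[ π , ∥ C ]       ∎
      where
      E : Matrix (suc m) (#∏ (tail k))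
      E = ∥ (λ i → C (suc i))

    -- At each output the contribution of `S` to the maximum is bounded by its sum over all inputs.
    -- Summed over the outputs, the rows collapse to one and the mass of `S` remains.
    V[]≤V[restrict-∁]+sumOver : (∀ x → 0# ≤ π x) → ∀ {l} {D : Matrix (suc m) l} → IsChannel D →
      ∀ S → V[ π , D ] ≤ V[ restrict π (∁ S) , D ] + sumOver π S
    V[]≤V[restrict-∁]+sumOver 0≤π {D = D} isD S = begin
      V[ π , D ]
        ≤⟨ sum-mono-≤ (λ y → maximum≤ _ λ x → begin
             π x * D x y               ≈⟨ *-congʳ (restrict-∁+restrict π S x) ⟩
             (π′ x + σ x) * D x y      ≈⟨ distribʳ (D x y) (π′ x) (σ x) ⟩
             π′ x * D x y + σ x * D x y
               ≤⟨ +-mono-≤ (≤maximum (λ z → π′ z * D z y) x)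
                    (term≤sum {f = λ z → σ z * D z y} (λ z → *-nonneg (0≤σ z) (IsChannel.nonneg isD z y)) x) ⟩
             maximum (λ z → π′ z * D z y) + sum (λ z → σ z * D z y) ∎) ⟩
      sum (λ y → maximum (λ x → π′ x * D x y) + sum (λ x → σ x * D x y))
        ≈⟨ ∑.∑-distrib-+ (λ y → maximum (λ x → π′ x * D x y)) (λ y → sum (λ x → σ x * D x y)) ⟩
      V[ π′ , D ] + sum (λ y → sum (λ x → σ x * D x y))
        ≈⟨ +-congˡ (∑.∑-comm (λ y x → σ x * D x y)) ⟩
      V[ π′ , D ] + sum (λ x → sum (λ y → σ x * D x y))
        ≈⟨ +-congˡ (∑.sum-cong-≋ λ x → ∑.*-distribˡ-sum (σ x) (D x)) ⟨
      V[ π′ , D ] + sum (λ x → σ x * sum (D x))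
        ≈⟨ +-congˡ (∑.sum-cong-≋ λ x → trans (*-congˡ (IsChannel.total isD x)) (*-identityʳ (σ x))) ⟩
      V[ π′ , D ] + sumOver π S ∎
      where
      π′ = restrict π (∁ S)
      σ  = restrict π S
      0≤σ = restrict-nonneg π S 0≤π

    -- A single element `x₀` outside `S` dominates every atom of `S`, so discarding `S` cannot lower
    -- the maximum.
    V≤V[restrict-∁] : (S : Subset (suc m)) (ne : Nonempty S) (ne∁ : Nonempty (∁ S)) →
      maxOver π S ne ≤ minOver π (∁ S) ne∁ → V π ≤ V (restrict π (∁ S))
    V≤V[restrict-∁] S ne ne∁@(x₀ , x₀∈∁S) max≤min = maximum≤ π π≤
      where
      π′ = restrict π (∁ S)
      ∈∁⇒≤ : ∀ {x} → x ∈ ∁ S → π x ≤ V π′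
      ∈∁⇒≤ {x} x∈∁S = ≤-trans (≤-reflexive (sym (restrict-∈ π (∁ S) x∈∁S))) (≤maximum π′ x)
      π≤ : ∀ x → π x ≤ V π′
      π≤ x with x ∈? S
      ... | no  x∉S = ∈∁⇒≤ (x∉p⇒x∈∁p x∉S)
      ... | yes x∈S = begin
        π x                ≤⟨ ≤maxOver π S ne x∈S ⟩
        maxOver π S ne     ≤⟨ max≤min ⟩
        minOver π (∁ S) ne∁ ≤⟨ minOver≤ π (∁ S) ne∁ x₀∈∁S ⟩
        π x₀               ≤⟨ ∈∁⇒≤ x₀∈∁S ⟩
        V π′               ∎

  -- If no entry were positive, the total mass `1#` would be at most `0#`.
  V-pos : {π : Vector Carrier (suc m)} → IsPrior π → 0# < V π
  V-pos {m} {π} isπ = ≰⇒> λ V≤0 → <⇒≱ 0<1 (begin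
    1#                        ≈⟨ IsPrior.total isπ ⟨
    sum π                     ≤⟨ sum-mono-≤ (λ x → ≤-trans (≤maximum π x) V≤0) ⟩
    sum (λ (_ : Fin (suc m)) → 0#) ≈⟨ ∑.sum-replicate-zero (suc m) ⟩
    0#                        ∎)

  -- The joint term contains `p` only once, while the product of the `suc n` separate bounds calls
  -- for it `suc n` times. The first factor takes `p`; each of the other `n` takes a `μ`, which is
  -- at most `p`.
  p*product*μ^n≤product : ∀ {p μ} {c b : Vector Carrier (suc n)} → 0# ≤ p → 0# ≤ μ → μ ≤ p →
    (∀ i → 0# ≤ c i) → (∀ i → p * c i ≤ b i) →
    p * product c * product (replicate n μ) ≤ product b
  p*product*μ^n≤product {n} {p} {μ} {c} {b} 0≤p 0≤μ μ≤p 0≤c pc≤b = begin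
    p * (c zero * product (tail c)) * product (replicate n μ)
      ≈⟨ solve 4 (λ a b d e → a :* (b :* d) :* e := a :* b :* (e :* d)) refl
           p (c zero) (product (tail c)) (product (replicate n μ)) ⟩
    p * c zero * (product (replicate n μ) * product (tail c))
      ≈⟨ *-congˡ (∏.∑-distrib-+ (replicate n μ) (tail c)) ⟨
    p * c zero * product (λ i → μ * tail c i)
      ≤⟨ *-mono-≤ (*-nonneg 0≤p (0≤c zero)) (product-nonneg λ i → *-nonneg 0≤μ (0≤c (suc i))) (pc≤b zero)
           (product-mono-≤ (λ i → *-nonneg 0≤μ (0≤c (suc i)))
             λ i → ≤-trans (*-monoʳ-≤ (0≤c (suc i)) μ≤p) (pc≤b (suc i))) ⟩
    product b ∎

  -- `bound` compares the two sides at each output tuple; summing over tuples then factorises the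
  -- right side by `sum-product-proj`.
  V[∥]*minNonzero^n≤product : {ρ π : Vector Carrier (suc m)} → (∀ x → 0# ≤ ρ x) → (∀ x → ρ x ≤ π x) →
    {k : Fin (suc n) → ℕ} {C : ∀ i → Matrix (suc m) (k i)} → (∀ i → IsChannel (C i)) →
    V[ ρ , ∥ C ] * product (replicate n (minNonzero ρ)) ≤ product (λ i → V[ π , C i ])
  V[∥]*minNonzero^n≤product {m} {n} {ρ} {π} 0≤ρ ρ≤π {k} {C} isC = begin
    V[ ρ , ∥ C ] * μⁿ
      ≈⟨ ∑.*-distribʳ-sum μⁿ (λ y → maximum (λ x → ρ x * ∥ C x y)) ⟩
    sum (λ y → maximum (λ x → ρ x * ∥ C x y) * μⁿ)
      -- Rather than moving `μⁿ` through the maximum, `bound` is divided by `μⁿ` underneath it and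
      -- multiplied back afterwards.
      ≤⟨ sum-mono-≤ (λ y → ≤-trans (*-monoʳ-≤ 0≤μⁿ (maximum≤ _ λ x → *≤⇒≤/ 0<μⁿ (bound x y)))
           (≤-reflexive (/-cancel (product (λ i → b i (proj k y i)))))) ⟩
    sum (λ y → product (λ i → b i (proj k y i)))
      ≈⟨ sum-product-proj k b ⟩
    product (λ i → V[ π , C i ]) ∎
    where
    μ  = minNonzero ρ
    μⁿ = product (replicate n μ)
    0<μⁿ = product-pos {n} {replicate n μ} λ _ → minNonzero-pos ρ 0≤ρ
    0≤μⁿ = proj₁ 0<μⁿ
    b : ∀ i → Fin (k i) → Carrier
    b i y = maximum (λ x → π x * C i x y)
    0≤C : ∀ i x y → 0# ≤ C i x y
    0≤C i = IsChannel.nonneg (isC i)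
    /-cancel : ∀ z → z / μⁿ * μⁿ ≈ z
    /-cancel z = begin-equality
      z * μⁿ ⁻¹ * μⁿ   ≈⟨ solve 3 (λ a b d → a :* b :* d := a :* (d :* b)) refl z (μⁿ ⁻¹) μⁿ ⟩
      z * (μⁿ * μⁿ ⁻¹) ≈⟨ *-congˡ (⁻¹-inverseʳ μⁿ (proj₂ 0<μⁿ ∘ sym)) ⟩
      z * 1#           ≈⟨ *-identityʳ z ⟩
      z                ∎
    bound : ∀ x y → ρ x * ∥ C x y * μⁿ ≤ product (λ i → b i (proj k y i))
    bound x y with ρ x ≟ 0#
    -- Off the support `μ ≤ ρ x` fails, but there the left side vanishes and the right side is
    -- nonnegative.
    ... | yes ρx≈0 = begin
      ρ x * ∥ C x y * μⁿ   ≈⟨ *-congʳ (trans (*-congʳ ρx≈0) (zeroˡ _)) ⟩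
      0# * μⁿ              ≈⟨ zeroˡ μⁿ ⟩
      0#                   ≤⟨ product-nonneg (λ i → maximum-nonneg λ z →
                                *-nonneg (≤-trans (0≤ρ z) (ρ≤π z)) (0≤C i z (proj k y i))) ⟩
      product (λ i → b i (proj k y i)) ∎
    ... | no  ρx≉0 = p*product*μ^n≤product (0≤ρ x) (proj₁ (minNonzero-pos ρ 0≤ρ)) (minNonzero≤ ρ ρx≉0)
      (λ i → 0≤C i x (proj k y i))
      (λ i → ≤-trans (*-monoʳ-≤ (0≤C i x (proj k y i)) (ρ≤π x)) (≤maximum (λ z → π z * C i z (proj k y i)) x))

  -- Passage from vulnerabilities to leakage.

  ·-mono-≤ : ∀ n {x y} → x ≤ y → n · x ≤ n · y
  ·-mono-≤ zero    x≤y = ≤-refl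
  ·-mono-≤ (suc n) x≤y = +-mono-≤ x≤y (·-mono-≤ n x≤y)

  -- Here a = log V(π), q = log V(π′), p = log μ, w = log W and vᵢ = log V(π, Cᵢ).
  leakage-arithmetic : ∀ {a p q w t} (v : Vector Carrier (suc n)) →
    a ≤ q → w + n · p ≤ sum v + t →
    - a - - w ≤ sum (λ i → - a - - v i) + n · (- p - - q) + t
  leakage-arithmetic {n} {a} {p} {q} {w} {t} v a≤q w+np≤ = begin
    - a - - w                                    ≈⟨ +-congˡ (-‿involutive w) ⟩
    - a + w                                      ≈⟨ +-identityʳ _ ⟨
    -- Zero is inserted as `n · (p - p)` to create the `n · p` that the hypothesis on `w` asks for.
    - a + w + 0#                                 ≈⟨ +-congˡ n[x-x]≈0 ⟨
    - a + w + n · (p - p)                        ≈⟨ +-congˡ (×-distrib-+ p (- p) n) ⟩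
    - a + w + (n · p + n · (- p))                ≈⟨ solve 4 (λ x y z u → x :+ y :+ (z :+ u) := (y :+ z) :+ (x :+ u)) refl
                                                      (- a) w (n · p) (n · (- p)) ⟩
    (w + n · p) + (- a + n · (- p))              ≤⟨ +-mono-≤ w+np≤ ≤-refl ⟩
    (sum v + t) + (- a + n · (- p))              ≈⟨ +-identityʳ _ ⟨
    -- The sum of leakages has `suc n` copies of `- a`, of which one is at hand. Inserting
    -- `n · (a - a)` supplies the others and leaves `n · a` to pair with `n · (- p)`.
    (sum v + t) + (- a + n · (- p)) + 0#         ≈⟨ +-congˡ n[x-x]≈0 ⟨
    (sum v + t) + (- a + n · (- p)) + n · (a - a) ≈⟨ +-congˡ (×-distrib-+ a (- a) n) ⟩
    (sum v + t) + (- a + n · (- p)) + (n · a + n · (- a))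
      ≈⟨ solve 6 (λ s t A P x y → (s :+ t) :+ (A :+ P) :+ (x :+ y) := (A :+ y :+ s) :+ (P :+ x) :+ t) refl
           (sum v) t (- a) (n · (- p)) (n · a) (n · (- a)) ⟩
    (suc n · (- a) + sum v) + (n · (- p) + n · a) + t
      ≈⟨ +-congʳ (+-cong sum-split (×-distrib-+ (- p) a n)) ⟨
    -- Here `a ≤ q` replaces the prior's vulnerability by that of its restriction.
    sum (λ i → - a - - v i) + n · (- p + a) + t  ≤⟨ +-mono-≤ (+-monoʳ-≤ _ (·-mono-≤ n (+-monoʳ-≤ (- p)
                                                      (≤-trans a≤q (≤-reflexive (sym (-‿involutive q))))))) ≤-refl ⟩
    sum (λ i → - a - - v i) + n · (- p - - q) + t ∎
    where
    n[x-x]≈0 : ∀ {x} → n · (x - x) ≈ 0#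
    n[x-x]≈0 {x} = begin-equality
      n · (x - x)                 ≈⟨ ∑.sum-replicate n ⟨
      sum (replicate n (x - x))   ≈⟨ ∑.sum-cong-≋ {n} (λ _ → -‿inverseʳ x) ⟩
      sum (replicate n 0#)        ≈⟨ ∑.sum-replicate-zero n ⟩
      0#                          ∎
    sum-split : sum (λ i → - a - - v i) ≈ suc n · (- a) + sum v
    sum-split = begin-equality
      sum (λ i → - a - - v i)             ≈⟨ ∑.sum-cong-≋ (λ i → +-congˡ {x = - a} (-‿involutive (v i))) ⟩
      sum (λ i → - a + v i)               ≈⟨ ∑.∑-distrib-+ (replicate (suc n) (- a)) v ⟩
      sum (replicate (suc n) (- a)) + sum v ≈⟨ +-congʳ (∑.sum-replicate (suc n)) ⟩
      suc n · (- a) + sum v               ∎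

-- The leakage bound for parallel composition with shared input.

proposition5p6 : ∀ {c ℓ₁ ℓ₂} (ℝ : Reals c ℓ₁ ℓ₂) (log₂ : BinaryLogarithm ℝ) →
    let open Reals ℝ
        open Leakage ℝ log₂
    in
    ∀ (n m : ℕ) (k : Fin (suc n) → ℕ)
      (C : ∀ i → Matrix (suc m) (suc (k i))) → (∀ i → IsChannel (C i)) →
    ∀ (π : Vector Carrier (suc m)) → IsPrior π →
    ∀ (X′ : Subset (suc m)) (X′-nonempty : Nonempty X′) (X′-proper : Nonempty (∁ X′)) →
    maxOver π X′ X′-nonempty ≤ minOver π (∁ X′) X′-proper →
    let ε    = sumOver π X′
        π′   = restrict π (∁ X′)
        maxV = maximum (λ j → V[ π , C j ])
    in
    ε < maxV →
    I∞[ π , ∥ C ] ≤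
      sum (λ i → I∞[ π , C i ]) + (suc n ∸ 1) · (Hmin π′ - H∞ π′) + log (maxV / (maxV - ε))
proposition5p6 ℝ log₂ n m k C isC π isπ X′ X′-nonempty X′-proper max≤min ε<maxV =
  -- With `suc n` channels, `suc n ∸ 1` reduces to `n`. What is left to show is the logarithm of
  -- `Wμⁿ≤`.
  leakage-arithmetic {n = n} (λ i → log V[ π , C i ]) (log-mono 0<Vπ Vπ≤Vπ′) (begin
    log W + n · log μ                     ≈⟨ +-congˡ (∑.sum-replicate n) ⟨
    log W + sum (replicate n (log μ))     ≈⟨ +-congˡ (log-product {f = replicate n μ} λ _ → 0<μ) ⟨
    log W + log μⁿ                        ≈⟨ log-* 0<W 0<μⁿ ⟨
    log (W * μⁿ)                          ≤⟨ log-mono (*-pos 0<W 0<μⁿ) Wμⁿ≤ ⟩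
    log (product Vᵢ * (maxV / (maxV - ε))) ≈⟨ log-* (product-pos 0<Vᵢ) (/-pos 0<maxV 0<maxV-ε) ⟩
    log (product Vᵢ) + log (maxV / (maxV - ε)) ≈⟨ +-congʳ (log-product 0<Vᵢ) ⟩
    sum (λ i → log (Vᵢ i)) + log (maxV / (maxV - ε)) ∎)
  where
  open Reals ℝ
  open OrderedField ℝ
  open Leakage ℝ log₂
  open BinaryLogarithm log₂ using (log-mono; log-*)
  open MinEntropy ℝ log₂
  open SemiringSolver commutativeSemiring using (solve; _:*_; _:=_)
  open PartialOrderReasoning poset using (begin_; step-≤; step-≈-⟩; step-≈-⟨; _∎)
  ε  = sumOver π X′
  π′ = restrict π (∁ X′)
  Vᵢ : Vector Carrier (suc n)
  Vᵢ i = V[ π , C i ]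
  maxV = maximum Vᵢ
  W  = V[ π , ∥ C ]
  W′ = V[ π′ , ∥ C ]
  μ  = minNonzero π′
  μⁿ = product (replicate n μ)
  0≤π = IsPrior.nonneg isπ
  0≤π′ = restrict-nonneg π (∁ X′) 0≤π
  0<Vπ = V-pos isπ
  Vπ≤Vπ′ = V≤V[restrict-∁] π X′ X′-nonempty X′-proper max≤min
  0<μ = minNonzero-pos π′ 0≤π′
  0<μⁿ = product-pos {f = replicate n μ} λ _ → 0<μ
  0≤ε : 0# ≤ ε
  0≤ε = sum-nonneg (restrict-nonneg π X′ 0≤π)
  0<maxV = ≤-<-trans 0≤ε ε<maxV
  0<maxV-ε = x<y⇒0<y-x ε<maxV
  0<Vᵢ : ∀ i → 0# < Vᵢ i
  0<Vᵢ i = <-≤-trans 0<Vπ (V≤V[] π (isC i))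
  maxV≤W : maxV ≤ W
  maxV≤W = maximum≤ Vᵢ (V[]-component≤V[∥] π isC)
  0<W = <-≤-trans 0<maxV maxV≤W
  Wμⁿ≤ : W * μⁿ ≤ product Vᵢ * (maxV / (maxV - ε))
  Wμⁿ≤ = begin
    W * μⁿ
      -- `W` is traded for `W′`, because the comparison through `μⁿ` concerns `π′`.
      ≤⟨ *-monoʳ-≤ (proj₁ 0<μⁿ) (*≤⇒≤/ 0<maxV-ε (w*[v-e]≤v*w′ 0≤ε (proj₁ 0<maxV) maxV≤W
           (V[]≤V[restrict-∁]+sumOver π 0≤π (∥-isChannel isC) X′))) ⟩
    (maxV * W′) / (maxV - ε) * μⁿ
      ≈⟨ solve 4 (λ a b d e → a :* b :* d :* e := b :* e :* (a :* d)) refl maxV W′ ((maxV - ε) ⁻¹) μⁿ ⟩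
    W′ * μⁿ * (maxV / (maxV - ε))
      ≤⟨ *-monoʳ-≤ (proj₁ (/-pos 0<maxV 0<maxV-ε))
           (V[∥]*minNonzero^n≤product 0≤π′ (restrict-≤ π (∁ X′) 0≤π) isC) ⟩
    product Vᵢ * (maxV / (maxV - ε)) ∎
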